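{- Let $(\overline{\mathfrak{p}};\overline{\mathfrak{q}})_{n}=(\mathfrak{p}_{1},\ldots,\mathfrak{p}_{n};\mathfrak{q}_{1},\ldots,\mathfrak{q}_{n})\in \mathcal{LMQB}_{n}$ and $(\overline{\mathfrak{l}};\overline{\mathfrak{s}})_{m}=(\mathfrak{l}_{1},\ldots,\mathfrak{l}_{m};\mathfrak{s}_{1},\ldots,\mathfrak{s}_{m})\in \mathcal{LMQB}_{m}$. For $k=1,\ldots,n-1$ let $(\overline{\mathfrak{p}};\overline{\mathfrak{q}})_{n}\circ_{k}(\overline{\mathfrak{l}};\overline{\mathfrak{s}})_{m}$ be the bi-vector whose first component is $$(\mathfrak{p}_{1},\ldots,\mathfrak{p}_{k-1},\ \mathfrak{l}_{1}-\mathfrak{s}_{1}(\mathfrak{p}_{k}+I),\ \mathfrak{l}_{2},\ldots,\mathfrak{l}_{m-1},\ \mathfrak{l}_{m}+I,\ \mathfrak{p}_{k+1}-\mathfrak{q}_{k+1},\ \mathfrak{p}_{k+2},\ldots,\mathfrak{p}_{n})$$ and whose second component is $$(\mathfrak{q}_{1},\ldots,\mathfrak{q}_{k-1},\ -\mathfrak{s}_{1}\mathfrak{q}_{k},\ \mathfrak{s}_{2},\ldots,\mathfrak{s}_{m},\ \mathfrak{q}_{k+1},\ldots,\mathfrak{q}_{n}),$$ and let $$(\overline{\mathfrak{p}};\overline{\mathfrak{q}})_{n}\circ_{n}(\overline{\mathfrak{l}};\overline{\mathfrak{s}})_{m}=(\mathfrak{p}_{1}-\mathfrak{q}_{1},\mathfrak{p}_{2},\ldots,\mathfrak{p}_{n-1},\mathfrak{l}_{1}-\mathfrak{s}_{1}(\mathfrak{p}_{n}+I),\mathfrak{l}_{2},\ldots,\mathfrak{l}_{m-1},\mathfrak{l}_{m}+I;\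 \mathfrak{q}_{1},\ldots,\mathfrak{q}_{n-1},-\mathfrak{s}_{1}\mathfrak{q}_{n},\mathfrak{s}_{2},\ldots,\mathfrak{s}_{m}).$$ Then $(\overline{\mathfrak{p}};\overline{\mathfrak{q}})_{n}\circ_{k}(\overline{\mathfrak{l}};\overline{\mathfrak{s}})_{m}\in \mathcal{LMQB}_{n+m-1}$ for $k=1,\ldots,n$.
   Context: Fix $l\ge 1$; all entries are $l\times l$ matrices (real or complex), $I$ and $O$ are the $l\times l$ identity and zero matrices. A bi-vector $(\mathfrak{p}_{1},\ldots,\mathfrak{p}_{n};\mathfrak{q}_{1},\ldots,\mathfrak{q}_{n})$ of $l\times l$ matrices is called a left matrix quiddity bi-sequence of length $n$ if $$\begin{pmatrix} \mathfrak{p}_{n} & \mathfrak{q}_{n}\\ I & O\end{pmatrix}\cdots\begin{pmatrix} \mathfrak{p}_{1} & \mathfrak{q}_{1}\\ I & O\end{pmatrix}=-\begin{pmatrix} I & O\\ O & I\end{pmatrix}.$$ $\mathcal{LMQB}_{n}$ is the set of all left matrix quiddity bi-sequences of length $n$. -}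

module Defs where

open import Algebra.Bundles using (CommutativeRing)
open import Data.Bool.Base using (if_then_else_)
open import Data.Fin.Base using (Fin; zero; suc; fromℕ; cast)
open import Data.Fin.Properties using (_≟_)
open import Data.Fin.Relation.Unary.Top using (view; ‵fromℕ; ‵inject₁)
open import Data.Nat.Base as ℕ using (ℕ; zero; suc)
open import Data.Nat.Properties using (+-comm)
open import Data.Vec.Functional
  using (Vector; head; tail; _∷_; _++_; zipWith; updateAt; foldr)
open import Level using (Level)
open import Relation.Nullary.Decidable.Core using (does)

private
  variable
    a : Level
    A : Set a
    d m n : ℕ

-- The cyclic successor: k ↦ k + 1 except that the last index goes to the first.
next : Fin (suc n) → Fin (suc n)
next k with view k
... | ‵fromℕ     = zero
... | ‵inject₁ j = suc j

-- (x₁,…,xₖ₋₁, y₁,…,yₘ₊₁, xₖ₊₁,…,xₙ₊₁): the k-th entry is replaced by a block.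
splice : Vector A (suc n) → Fin (suc n) → Vector A (suc m) → Vector A (n ℕ.+ suc m)
splice {n = n} {m = m} xs zero ys i = (ys ++ tail xs) (cast lengths i)
  where lengths = +-comm n (suc m)
splice {n = suc _} xs (suc k) ys = head xs ∷ splice (tail xs) k ys

module Matrices {r ℓ} (R : CommutativeRing r ℓ) where

  open CommutativeRing R
  open import Algebra.Properties.Semiring.Sum semiring using (sum)

  Matrix : ℕ → ℕ → Set r
  Matrix m n = Vector (Vector Carrier n) m

  infix  4 _≈ᴹ_
  infixl 6 _+ᴹ_ _-ᴹ_
  infixl 7 _*ᴹ_
  infix  8 -ᴹ_

  _≈ᴹ_ : Matrix m n → Matrix m n → Set ℓ
  A ≈ᴹ B = ∀ i j → A i j ≈ B i j

  0ᴹ : Matrix m n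
  0ᴹ i j = 0#

  1ᴹ : Matrix n n
  1ᴹ i j = if does (i ≟ j) then 1# else 0#

  _+ᴹ_ : Matrix m n → Matrix m n → Matrix m n
  (A +ᴹ B) i j = A i j + B i j

  -ᴹ_ : Matrix m n → Matrix m n
  (-ᴹ A) i j = - A i j

  _-ᴹ_ : Matrix m n → Matrix m n → Matrix m n
  A -ᴹ B = A +ᴹ (-ᴹ B)

  _*ᴹ_ : Matrix m n → Matrix n d → Matrix m d
  (A *ᴹ B) i j = sum (λ k → A i k * B k j)

module Quiddity {r ℓ} (R : CommutativeRing r ℓ) (l : ℕ) where

  open Matrices R public

  -- (𝔭₁,…,𝔭ₙ ; 𝔮₁,…,𝔮ₙ); the entry of index i is stored at position i - 1.
  record BiVector (n : ℕ) : Set r where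
    constructor _⨾_
    field
      𝔭 𝔮 : Vector (Matrix l l) n

  open BiVector public

  block : (A B C D : Matrix l l) → Matrix (l ℕ.+ l) (l ℕ.+ l)
  block A B C D = zipWith _++_ A B ++ zipWith _++_ C D

  elementary : Matrix l l → Matrix l l → Matrix (l ℕ.+ l) (l ℕ.+ l)
  elementary p q = block p q 1ᴹ 0ᴹ

  -- Mₙ ⋯ M₁, so later entries stand further to the left.
  leftProduct : Vector (Matrix d d) n → Matrix d d
  leftProduct = foldr (λ M acc → acc *ᴹ M) 1ᴹ

  LMQB : ∀ n → BiVector n → Set ℓ
  LMQB n (p ⨾ q) = leftProduct (zipWith elementary p q) ≈ᴹ -ᴹ block 1ᴹ 0ᴹ 0ᴹ 1ᴹ

  -- The entry of `p` following position k, cyclically, is changed as well; this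
  -- covers k < n + 1 (𝔭ₖ₊₁ - 𝔮ₖ₊₁) and k = n + 1 (𝔭₁ - 𝔮₁) at once.
  -- If m = 0 the only entry of the inserted block receives both modifications;
  -- if n = 0 the modified entry is the one that is replaced.  Over a nontrivial
  -- ring with l ≥ 1 there is no quiddity bi-sequence of length 1.
  infix 5 _∘[_]_

  _∘[_]_ : BiVector (suc n) → Fin (suc n) → BiVector (suc m) → BiVector (n ℕ.+ suc m)
  _∘[_]_ {m = m} (p ⨾ q) k (u ⨾ s) = splice p′ k u′ ⨾ splice q k s′
    where
    p′ = updateAt p (next k) (_-ᴹ q (next k))
    u′ = updateAt (updateAt u zero (_-ᴹ s zero *ᴹ (p k +ᴹ 1ᴹ))) (fromℕ m) (_+ᴹ 1ᴹ)
    s′ = updateAt s zero (λ s₁ → -ᴹ (s₁ *ᴹ q k))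

{-# OPTIONS --safe #-}

-- Put K = (I O ; I I), and write M(p,q) for the elementary factor (p q ; I O).
-- The inserted factors multiply to
--   (I I ; O I) · M(𝔩ₘ,𝔰ₘ) ⋯ M(𝔩₁,𝔰₁) · (I O ; -(𝔭ₖ+I) -𝔮ₖ),
-- whose middle part is -1 by hypothesis, so that they multiply to K · M(𝔭ₖ,𝔮ₖ).
-- The factor following them (cyclically) is M(𝔭ₖ₊₁,𝔮ₖ₊₁) · K⁻¹.  For k < n the two
-- corrections cancel; for k = n they conjugate the central element -1 by K.

module Submission where

open import Defs
open import Algebra.Bundles using (CommutativeRing; Monoid; Ring)
import Algebra.Construct.Flip.Op as Flip
import Algebra.Construct.Pointwise as Pointwise
import Algebra.Properties.Monoid.Sum
import Algebra.Properties.Ring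
import Algebra.Properties.Semiring.Sum
open import Data.Bool.Base using (if_then_else_)
open import Data.Fin.Base using (Fin; zero; suc; fromℕ; inject₁; cast; splitAt; _↑ˡ_; _↑ʳ_)
open import Data.Fin.Properties
  using ( _≟_; suc-injective; fromℕ≢inject₁; ↑ˡ-injective; ↑ʳ-injective; splitAt-↑ˡ; splitAt-↑ʳ
        ; splitAt⁻¹-↑ˡ; splitAt⁻¹-↑ʳ)
open import Data.Fin.Relation.Unary.Top using (view; ‵fromℕ; ‵inject₁)
open import Data.Nat.Base using (ℕ; zero; suc; _+_; _∸_; _≤_)
open import Data.Nat.Properties as ℕ using (+-comm)
open import Data.Product.Base using (_,_)
open import Data.Sum.Base using (inj₁; inj₂)
open import Data.Sum.Properties using ([,]-map)
open import Data.Vec.Functional using (Vector; head; tail; last; _∷_; _++_; zipWith; updateAt)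
open import Data.Vec.Functional.Properties using (updateAt-updates; updateAt-minimal; lookup-++ʳ)
open import Function.Base using (const; _∘_)
open import Function.Bundles using (_⇔_; mk⇔)
open import Level using (Level)
open import Relation.Binary.PropositionalEquality as ≡ using (_≡_; _≢_)
import Relation.Binary.Reasoning.Setoid
open import Relation.Nullary.Decidable using (does-⇔; dec-false)

private
  variable
    a b c : Level
    A B C : Set a
    d m n o : ℕ

-- Splicing of vectors and the cyclic successor.

zipWith-++ : ∀ (f : A → B → C) (xs : Vector A m) (xs′ : Vector A n)
             (ys : Vector B m) (ys′ : Vector B n) i →
             zipWith f (xs ++ xs′) (ys ++ ys′) i ≡ (zipWith f xs ys ++ zipWith f xs′ ys′) i
zipWith-++ {m = m} f xs xs′ ys ys′ i with splitAt m i
... | inj₁ _ = ≡.refl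
... | inj₂ _ = ≡.refl

-- Splicing both components of a bi-vector thereby splices the elementary factors, which reduces the
-- composition to replacing one factor of a product by a block of factors.
zipWith-splice : ∀ (f : A → B → C) (xs : Vector A (suc n)) (ys : Vector B (suc n)) k
                 (xs′ : Vector A (suc m)) (ys′ : Vector B (suc m)) i →
                 zipWith f (splice xs k xs′) (splice ys k ys′) i ≡
                 splice (zipWith f xs ys) k (zipWith f xs′ ys′) i
zipWith-splice {n = n} {m = m} f xs ys zero xs′ ys′ i =
  zipWith-++ f xs′ (tail xs) ys′ (tail ys) (cast (+-comm n (suc m)) i)
zipWith-splice {n = suc _} f xs ys (suc k) xs′ ys′ zero    = ≡.refl
zipWith-splice {n = suc _} f xs ys (suc k) xs′ ys′ (suc i) =
  zipWith-splice f (tail xs) (tail ys) k xs′ ys′ i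

-- From length two on, the position that receives the correction of `𝔭` differs from `k`, so the
-- correction survives when position `k` is overwritten.
next≢ : (k : Fin (suc (suc n))) → next k ≢ k
next≢ k with view k
... | ‵fromℕ     = λ ()
... | ‵inject₁ j = suc≢inject₁ j
  where
  suc≢inject₁ : ∀ {n} (j : Fin n) → suc j ≢ inject₁ j
  suc≢inject₁ zero    ()
  suc≢inject₁ (suc j) eq = suc≢inject₁ j (suc-injective eq)

-- Products over vectors in a noncommutative monoid.

module MonoidSums {c ℓ} (M : Monoid c ℓ) where

  open Monoid M
  open Algebra.Properties.Monoid.Sum M public
    using (sum; sum-cong-≋; sum-cong-≗; sum-init-last)
  open Relation.Binary.Reasoning.Setoid setoid

  sum-++ : (xs : Vector Carrier m) (ys : Vector Carrier n) →
           sum (xs ++ ys) ≈ sum xs ∙ sum ys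
  sum-++ {m = zero}  xs ys = sym (identityˡ _)
  sum-++ {m = suc m} xs ys = begin
    -- `splitAt (suc m)` at a successor index is a mapped `splitAt m`, so the two tails agree only
    -- pointwise.
    head xs ∙ sum (tail (xs ++ ys))   ≡⟨ ≡.cong (head xs ∙_) (sum-cong-≗ ([,]-map ∘ splitAt m)) ⟩
    head xs ∙ sum (tail xs ++ ys)     ≈⟨ ∙-congˡ (sum-++ (tail xs) ys) ⟩
    head xs ∙ (sum (tail xs) ∙ sum ys) ≈⟨ assoc _ _ _ ⟨
    sum xs ∙ sum ys                   ∎

  -- Removes the coercion from length `n + suc m` to `suc m + n` that is built into `splice`.
  sum-cast : .(eq : m ≡ n) (xs : Vector Carrier n) → sum (xs ∘ cast eq) ≡ sum xs
  sum-cast {m = zero}  {zero}  eq xs = ≡.refl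
  sum-cast {m = suc m} {suc n} eq xs =
    ≡.cong (head xs ∙_) (sum-cast {m} {n} (ℕ.suc-injective eq) (tail xs))

  -- By associativity a block contributes only its product, so it may be contracted to a single
  -- entry. This restores the original length, and vectors can then be compared position by
  -- position.
  sum-splice : (xs : Vector Carrier (suc n)) (k : Fin (suc n)) (ys : Vector Carrier (suc m)) →
               sum (splice xs k ys) ≈ sum (updateAt xs k (const (sum ys)))
  sum-splice {n = n} {m = m} xs zero ys = begin
    sum ((ys ++ tail xs) ∘ cast (+-comm n (suc m))) ≡⟨ sum-cast (+-comm n (suc m)) (ys ++ tail xs) ⟩
    sum (ys ++ tail xs)                             ≈⟨ sum-++ ys (tail xs) ⟩
    sum ys ∙ sum (tail xs)                          ∎
  sum-splice {n = suc _} xs (suc k) ys = ∙-congˡ (sum-splice (tail xs) k ys)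

  sum-head : ∀ {a} (xs ys : Vector Carrier (suc n)) →
             ys zero ≈ a ∙ xs zero → (∀ i → ys (suc i) ≈ xs (suc i)) → sum ys ≈ a ∙ sum xs
  sum-head xs ys ys₀ ysᵢ = trans (∙-cong ys₀ (sum-cong-≋ ysᵢ)) (assoc _ _ _)

  sum-last : ∀ {n a} (xs ys : Vector Carrier (suc n)) →
             ys (fromℕ n) ≈ xs (fromℕ n) ∙ a → (∀ i → i ≢ fromℕ n → ys i ≈ xs i) →
             sum ys ≈ sum xs ∙ a
  sum-last {n} {a} xs ys ysₙ ysᵢ = begin
    sum ys                               ≈⟨ sum-init-last ys ⟩
    sum (ys ∘ inject₁) ∙ last ys         ≈⟨ ∙-cong (sum-cong-≋ {n} λ i → ysᵢ (inject₁ i) (fromℕ≢inject₁ ∘ ≡.sym)) ysₙ ⟩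
    sum (xs ∘ inject₁) ∙ (last xs ∙ a)   ≈⟨ assoc _ _ _ ⟨
    sum (xs ∘ inject₁) ∙ last xs ∙ a     ≈⟨ ∙-congʳ (sum-init-last xs) ⟨
    sum xs ∙ a                           ∎

  module _ {a b : Carrier} (ab≈ε : a ∙ b ≈ ε) where

    cancel-middle : ∀ x y → (x ∙ a) ∙ (b ∙ y) ≈ x ∙ y
    cancel-middle x y = begin
      (x ∙ a) ∙ (b ∙ y) ≈⟨ assoc _ _ _ ⟩
      x ∙ (a ∙ (b ∙ y)) ≈⟨ ∙-congˡ (assoc _ _ _) ⟨
      x ∙ ((a ∙ b) ∙ y) ≈⟨ ∙-congˡ (∙-congʳ ab≈ε) ⟩
      x ∙ (ε ∙ y)       ≈⟨ ∙-congˡ (identityˡ y) ⟩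
      x ∙ y             ∎

    -- The `a` that closes entry `j` stands right before the `b` that opens the next entry, and the
    -- two cancel inside the product.
    sum-adjacent : (xs ys : Vector Carrier (suc n)) (j : Fin n) →
                   ys (inject₁ j) ≈ xs (inject₁ j) ∙ a → ys (suc j) ≈ b ∙ xs (suc j) →
                   (∀ i → i ≢ inject₁ j → i ≢ suc j → ys i ≈ xs i) →
                   sum ys ≈ sum xs
    sum-adjacent xs ys zero ysⱼ ysⱼ₊₁ ysᵢ =
      trans (∙-cong ysⱼ (sum-head (tail xs) (tail ys) ysⱼ₊₁ λ i → ysᵢ _ (λ ()) (λ ())))
            (cancel-middle _ _)
    sum-adjacent xs ys (suc j) ysⱼ ysⱼ₊₁ ysᵢ =
      ∙-cong (ysᵢ zero (λ ()) (λ ()))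
             (sum-adjacent (tail xs) (tail ys) j ysⱼ ysⱼ₊₁
               λ i i≢j i≢j₊₁ → ysᵢ (suc i) (i≢j ∘ suc-injective)
                                          (i≢j₊₁ ∘ suc-injective))

    -- Before the last position the corrections are neighbours and cancel by `a ∙ b ≈ ε`. At the
    -- last position they stand at opposite ends and give `b ∙ z ∙ a`; moving `b` past `z` brings
    -- them together in the other order, where `b ∙ a ≈ ε` applies.
    sum-cyclicallyAdjacent :
      ∀ {z} → b ∙ a ≈ ε → b ∙ z ≈ z ∙ b →
      (xs ys : Vector Carrier (suc (suc n))) (k : Fin (suc (suc n))) →
      ys k ≈ xs k ∙ a → ys (next k) ≈ b ∙ xs (next k) →
      (∀ i → i ≢ k → i ≢ next k → ys i ≈ xs i) →
      sum xs ≈ z → sum ys ≈ z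
    -- The hypotheses on `ys` are bound only after the match on `view k`, so that `next k` has
    -- already reduced in their types.
    sum-cyclicallyAdjacent {n} {z} ba≈ε bz≈zb xs ys k with view k
    ... | ‵inject₁ j = λ ysₖ ysₖ₊₁ ysᵢ xs≈z → trans (sum-adjacent xs ys j ysₖ ysₖ₊₁ ysᵢ) xs≈z
    ... | ‵fromℕ     = λ ysₖ ysₖ₊₁ ysᵢ xs≈z → begin
      sum ys                           ≈⟨ ∙-cong ysₖ₊₁ (sum-last (tail xs) (tail ys) ysₖ
                                            λ i i≢ → ysᵢ (suc i) (i≢ ∘ suc-injective) λ ()) ⟩
      (b ∙ head xs) ∙ (sum (tail xs) ∙ a) ≈⟨ assoc _ _ _ ⟨
      ((b ∙ head xs) ∙ sum (tail xs)) ∙ a ≈⟨ ∙-congʳ (assoc _ _ _) ⟩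
      (b ∙ sum xs) ∙ a                 ≈⟨ ∙-congʳ (∙-congˡ xs≈z) ⟩
      (b ∙ z) ∙ a                      ≈⟨ ∙-congʳ bz≈zb ⟩
      (z ∙ b) ∙ a                      ≈⟨ assoc _ _ _ ⟩
      z ∙ (b ∙ a)                      ≈⟨ ∙-congˡ ba≈ε ⟩
      z ∙ ε                            ≈⟨ identityʳ z ⟩
      z                                ∎

-- The ring of square matrices.

module MatrixAlgebra {r ℓ} (R : CommutativeRing r ℓ) where

  open CommutativeRing R renaming (_+_ to _⊕_)
  open Matrices R
  open Algebra.Properties.Semiring.Sum semiring
  open Relation.Binary.Reasoning.Setoid setoid

  *ᴹ-cong : {A A′ : Matrix m n} {B B′ : Matrix n o} →
            A ≈ᴹ A′ → B ≈ᴹ B′ → A *ᴹ B ≈ᴹ A′ *ᴹ B′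
  *ᴹ-cong A≈A′ B≈B′ i j = sum-cong-≋ λ k → *-cong (A≈A′ i k) (B≈B′ k j)

  *ᴹ-assoc : (A : Matrix m n) (B : Matrix n o) (C : Matrix o d) →
             (A *ᴹ B) *ᴹ C ≈ᴹ A *ᴹ (B *ᴹ C)
  *ᴹ-assoc {n = n} {o = o} A B C i j = begin
    (∑[ k < o ] ((∑[ h < n ] (A i h * B h k)) * C k j))
      ≈⟨ sum-cong-≋ (λ k → *-distribʳ-sum (C k j) (λ h → A i h * B h k)) ⟩
    (∑[ k < o ] (∑[ h < n ] (A i h * B h k * C k j)))
      ≈⟨ ∑-comm (λ k h → A i h * B h k * C k j) ⟩
    (∑[ h < n ] (∑[ k < o ] (A i h * B h k * C k j)))
      ≈⟨ sum-cong-≋ (λ h → sum-cong-≋ λ k → *-assoc (A i h) (B h k) (C k j)) ⟩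
    (∑[ h < n ] (∑[ k < o ] (A i h * (B h k * C k j))))
      ≈⟨ sum-cong-≋ (λ h → *-distribˡ-sum (A i h) (λ k → B h k * C k j)) ⟨
    (∑[ h < n ] (A i h * (∑[ k < o ] (B h k * C k j)))) ∎

  *ᴹ-distribˡ-+ᴹ : (A : Matrix m n) (B C : Matrix n o) → A *ᴹ (B +ᴹ C) ≈ᴹ A *ᴹ B +ᴹ A *ᴹ C
  *ᴹ-distribˡ-+ᴹ {n = n} A B C i j =
    trans (sum-cong-≋ {n} λ k → distribˡ (A i k) (B k j) (C k j)) (∑-distrib-+ {n} _ _)

  *ᴹ-distribʳ-+ᴹ : (A : Matrix n o) (B C : Matrix m n) → (B +ᴹ C) *ᴹ A ≈ᴹ B *ᴹ A +ᴹ C *ᴹ A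
  *ᴹ-distribʳ-+ᴹ {n = n} A B C i j =
    trans (sum-cong-≋ {n} λ k → distribʳ (A k j) (B i k) (C i k)) (∑-distrib-+ {n} _ _)

  sum-zero : (xs : Vector Carrier n) → (∀ i → xs i ≈ 0#) → sum xs ≈ 0#
  sum-zero {n = n} xs xs≈0 = trans (sum-cong-≋ xs≈0) (sum-replicate-zero n)

  sum-1ᴹˡ : (i : Fin n) (xs : Vector Carrier n) → sum (λ k → 1ᴹ i k * xs k) ≈ xs i
  sum-1ᴹˡ zero    xs = trans (+-cong (*-identityˡ _) (sum-zero (λ k → 0# * tail xs k) (zeroˡ ∘ tail xs))) (+-identityʳ _)
  -- `does (suc i ≟ suc k)` computes to `does (i ≟ k)`, so past its leading zero this row of `1ᴹ` is
  -- row `i` of the smaller identity by definition.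
  sum-1ᴹˡ (suc i) xs = trans (+-cong (zeroˡ _) (sum-1ᴹˡ i (tail xs))) (+-identityˡ _)

  sum-1ᴹʳ : (j : Fin n) (xs : Vector Carrier n) → sum (λ k → xs k * 1ᴹ k j) ≈ xs j
  sum-1ᴹʳ zero    xs = trans (+-cong (*-identityʳ _) (sum-zero (λ k → tail xs k * 0#) (zeroʳ ∘ tail xs))) (+-identityʳ _)
  sum-1ᴹʳ (suc j) xs = trans (+-cong (zeroʳ _) (sum-1ᴹʳ j (tail xs))) (+-identityˡ _)

  -- Used at two sizes: `l` for the entries of the blocks and `l + l` for the factors of the
  -- product.
  matrixRing : ℕ → Ring r ℓ
  matrixRing n = record
    { Carrier = Matrix n n
    ; _≈_     = _≈ᴹ_
    ; _+_     = _+ᴹ_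
    ; _*_     = _*ᴹ_
    ; -_      = -ᴹ_
    ; 0#      = 0ᴹ
    ; 1#      = 1ᴹ
    ; isRing  = record
      { +-isAbelianGroup = Pointwise.isAbelianGroup (Fin n)
                             (Pointwise.isAbelianGroup (Fin n) +-isAbelianGroup)
      ; *-cong           = *ᴹ-cong
      ; *-assoc          = *ᴹ-assoc
      ; *-identity       = (λ A i j → sum-1ᴹˡ i (λ k → A k j)) , (λ A i j → sum-1ᴹʳ j (A i))
      ; distrib          = *ᴹ-distribˡ-+ᴹ , *ᴹ-distribʳ-+ᴹ
      }
    }

-- Arithmetic of two-by-two block matrices.

module BlockAlgebra {r ℓ} (R : CommutativeRing r ℓ) (l : ℕ) where

  open CommutativeRing R renaming (_+_ to _⊕_)
  open Quiddity R l
  open Algebra.Properties.Semiring.Sum semiring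
  open MonoidSums +-monoid using (sum-++)
  open Relation.Binary.Reasoning.Setoid setoid

  block-cong : ∀ {A A′ B B′ C C′ D D′} → A ≈ᴹ A′ → B ≈ᴹ B′ → C ≈ᴹ C′ → D ≈ᴹ D′ →
               block A B C D ≈ᴹ block A′ B′ C′ D′
  block-cong A≈ B≈ C≈ D≈ i j with splitAt l i
  block-cong A≈ B≈ C≈ D≈ i j | inj₁ i′ with splitAt l j
  ... | inj₁ j′ = A≈ i′ j′
  ... | inj₂ j′ = B≈ i′ j′
  block-cong A≈ B≈ C≈ D≈ i j | inj₂ i′ with splitAt l j
  ... | inj₁ j′ = C≈ i′ j′
  ... | inj₂ j′ = D≈ i′ j′

  -ᴹ-block : ∀ A B C D → -ᴹ block A B C D ≈ᴹ block (-ᴹ A) (-ᴹ B) (-ᴹ C) (-ᴹ D)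
  -ᴹ-block A B C D i j with splitAt l i
  -ᴹ-block A B C D i j | inj₁ i′ with splitAt l j
  ... | inj₁ _ = refl
  ... | inj₂ _ = refl
  -ᴹ-block A B C D i j | inj₂ i′ with splitAt l j
  ... | inj₁ _ = refl
  ... | inj₂ _ = refl

  -- The products of entries again form a concatenation, so the sum over `l + l` indices splits at
  -- `l`. Each half of a row of a block product is one instance of this.
  row-*-block : ∀ (xs ys : Vector Carrier l) A B C D j →
    sum (λ k → (xs ++ ys) k * block A B C D k j) ≈
    sum (λ k → xs k * (A k ++ B k) j) ⊕ sum (λ k → ys k * (C k ++ D k) j)
  row-*-block xs ys A B C D j = trans (sum-cong-≋ split) (sum-++ {m = l} {n = l} _ _)
    where
    split : ∀ k → (xs ++ ys) k * block A B C D k j ≈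
                  ((λ k → xs k * (A k ++ B k) j) ++ (λ k → ys k * (C k ++ D k) j)) k
    split k with splitAt l k
    ... | inj₁ _ = refl
    ... | inj₂ _ = refl

  block-* : ∀ A B C D A′ B′ C′ D′ →
            block A B C D *ᴹ block A′ B′ C′ D′ ≈ᴹ
            block (A *ᴹ A′ +ᴹ B *ᴹ C′) (A *ᴹ B′ +ᴹ B *ᴹ D′)
                  (C *ᴹ A′ +ᴹ D *ᴹ C′) (C *ᴹ B′ +ᴹ D *ᴹ D′)
  block-* A B C D A′ B′ C′ D′ i j with splitAt l i
  ... | inj₁ i′ = trans (row-*-block (A i′) (B i′) A′ B′ C′ D′ j) entries
    where
    entries : sum (λ k → A i′ k * (A′ k ++ B′ k) j) ⊕ sum (λ k → B i′ k * (C′ k ++ D′ k) j) ≈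
              ((A *ᴹ A′ +ᴹ B *ᴹ C′) i′ ++ (A *ᴹ B′ +ᴹ B *ᴹ D′) i′) j
    entries with splitAt l j
    ... | inj₁ _ = refl
    ... | inj₂ _ = refl
  ... | inj₂ i′ = trans (row-*-block (C i′) (D i′) A′ B′ C′ D′ j) entries
    where
    entries : sum (λ k → C i′ k * (A′ k ++ B′ k) j) ⊕ sum (λ k → D i′ k * (C′ k ++ D′ k) j) ≈
              ((C *ᴹ A′ +ᴹ D *ᴹ C′) i′ ++ (C *ᴹ B′ +ᴹ D *ᴹ D′) i′) j
    entries with splitAt l j
    ... | inj₁ _ = refl
    ... | inj₂ _ = refl

  1ᴹ-cong : {i j : Fin m} {i′ j′ : Fin n} → i ≡ j ⇔ i′ ≡ j′ → 1ᴹ i j ≡ 1ᴹ i′ j′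
  1ᴹ-cong {i = i} {j} {i′} {j′} eq =
    ≡.cong (if_then 1# else 0#) (does-⇔ eq (i ≟ j) (i′ ≟ j′))

  1ᴹ-≢ : {i j : Fin n} → i ≢ j → 1ᴹ i j ≡ 0#
  1ᴹ-≢ {i = i} {j} i≢j = ≡.cong (if_then 1# else 0#) (dec-false (i ≟ j) i≢j)

  ↑ˡ≢↑ʳ : (i : Fin m) (j : Fin n) → i ↑ˡ n ≢ m ↑ʳ j
  ↑ˡ≢↑ʳ {m = m} {n = n} i j eq
    with () ← ≡.trans (≡.sym (splitAt-↑ˡ m i n)) (≡.trans (≡.cong (splitAt m) eq) (splitAt-↑ʳ m n j))

  -- An entry of the identity depends only on whether its two indices agree. The diagonal blocks
  -- match because the embeddings `_↑ˡ l` and `l ↑ʳ_` are injective, and the other blocks vanish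
  -- because their images are disjoint.
  block-1ᴹ : block 1ᴹ 0ᴹ 0ᴹ 1ᴹ ≈ᴹ 1ᴹ
  block-1ᴹ i j with splitAt l i in eqᵢ
  block-1ᴹ i j | inj₁ i′ with splitAt l j in eqⱼ
  -- The recorded equations express `i` and `j` as embedded indices, which makes the entry of the
  -- large identity comparable with one of size `l`.
  ... | inj₁ j′ rewrite ≡.sym (splitAt⁻¹-↑ˡ eqᵢ) | ≡.sym (splitAt⁻¹-↑ˡ eqⱼ) =
    reflexive (1ᴹ-cong (mk⇔ (≡.cong (_↑ˡ l)) (↑ˡ-injective l i′ j′)))
  ... | inj₂ j′ rewrite ≡.sym (splitAt⁻¹-↑ˡ eqᵢ) | ≡.sym (splitAt⁻¹-↑ʳ {l} eqⱼ) =
    reflexive (≡.sym (1ᴹ-≢ (↑ˡ≢↑ʳ i′ j′)))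
  block-1ᴹ i j | inj₂ i′ with splitAt l j in eqⱼ
  ... | inj₁ j′ rewrite ≡.sym (splitAt⁻¹-↑ʳ {l} eqᵢ) | ≡.sym (splitAt⁻¹-↑ˡ eqⱼ) =
    reflexive (≡.sym (1ᴹ-≢ (↑ˡ≢↑ʳ j′ i′ ∘ ≡.sym)))
  ... | inj₂ j′ rewrite ≡.sym (splitAt⁻¹-↑ʳ {l} eqᵢ) | ≡.sym (splitAt⁻¹-↑ʳ {l} eqⱼ) =
    reflexive (1ᴹ-cong (mk⇔ (≡.cong (l ↑ʳ_)) (↑ʳ-injective l i′ j′)))

-- Ring identities to which the block computations reduce, entry by entry.

module RingIdentities {c ℓ} (S : Ring c ℓ) where

  open Ring S renaming (_+_ to _⊕_)
  open Algebra.Properties.Ring S using (-‿distribˡ-*; -‿distribʳ-*; -‿involutive; ⁻¹-anti-homo‿-)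

  1*x+0*y≈x : ∀ x y → 1# * x ⊕ 0# * y ≈ x
  1*x+0*y≈x x y = trans (+-cong (*-identityˡ x) (zeroˡ y)) (+-identityʳ x)

  0*x+1*y≈y : ∀ x y → 0# * x ⊕ 1# * y ≈ y
  0*x+1*y≈y x y = trans (+-cong (zeroˡ x) (*-identityˡ y)) (+-identityˡ y)

  1*x+1*y≈x+y : ∀ x y → 1# * x ⊕ 1# * y ≈ x ⊕ y
  1*x+1*y≈x+y x y = +-cong (*-identityˡ x) (*-identityˡ y)

  x*0+y*z≈y*z : ∀ x y z → x * 0# ⊕ y * z ≈ y * z
  x*0+y*z≈y*z x y z = trans (+-congʳ (zeroʳ x)) (+-identityˡ (y * z))

  x*0+y*1≈y : ∀ x y → x * 0# ⊕ y * 1# ≈ y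
  x*0+y*1≈y x y = trans (x*0+y*z≈y*z x y 1#) (*-identityʳ y)

  x*1+y*-z≈x-y*z : ∀ x y z → x * 1# ⊕ y * - z ≈ x - y * z
  x*1+y*-z≈x-y*z x y z = +-cong (*-identityʳ x) (sym (-‿distribʳ-* y z))

  x*1+y*-1≈x-y : ∀ x y → x * 1# ⊕ y * - 1# ≈ x - y
  x*1+y*-1≈x-y x y = trans (x*1+y*-z≈x-y*z x y 1#) (+-congˡ (-‿cong (*-identityʳ y)))

  -[y-[x+y]]≈x : ∀ x y → - (y - (x ⊕ y)) ≈ x
  -[y-[x+y]]≈x x y =
    trans (⁻¹-anti-homo‿- y (x ⊕ y))
      (trans (+-assoc x y (- y)) (trans (+-congˡ (-‿inverseʳ y)) (+-identityʳ x)))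

  -[0-x]≈x : ∀ x → - (0# - x) ≈ x
  -[0-x]≈x x = trans (-‿cong (+-identityˡ (- x))) (-‿involutive x)

  x*-1*y≈-[x*y] : ∀ x y → (x * - 1#) * y ≈ - (x * y)
  x*-1*y≈-[x*y] x y =
    trans (*-congʳ (trans (sym (-‿distribʳ-* x 1#)) (-‿cong (*-identityʳ x)))) (sym (-‿distribˡ-* x y))

  -1-central : ∀ x → - 1# * x ≈ x * - 1#
  -1-central x =
    trans (trans (sym (-‿distribˡ-* 1# x)) (-‿cong (trans (*-identityˡ x) (sym (*-identityʳ x)))))
      (-‿distribʳ-* x 1#)

-- Elementary factors and their corrections.

module Factors {r ℓ} (R : CommutativeRing r ℓ) (l : ℕ) where

  open Quiddity R l
  open MatrixAlgebra R using (matrixRing)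
  open BlockAlgebra R l
  open RingIdentities (matrixRing l)
  private
    module S = Ring (matrixRing l)
    module T = Ring (matrixRing (l + l))
    module SP = Algebra.Properties.Ring (matrixRing l)

  K K⁻¹ U : Matrix (l + l) (l + l)
  K   = block 1ᴹ 0ᴹ 1ᴹ 1ᴹ
  K⁻¹ = block 1ᴹ 0ᴹ (-ᴹ 1ᴹ) 1ᴹ
  U   = block 1ᴹ 1ᴹ 0ᴹ 1ᴹ

  -- This is `-U⁻¹ K M(p,q)`, the solution of `-(U X) = K M(p,q)`; the term `p + I` and the signs in
  -- the composition originate here.
  X : Matrix l l → Matrix l l → Matrix (l + l) (l + l)
  X p q = block 1ᴹ 0ᴹ (-ᴹ (p +ᴹ 1ᴹ)) (-ᴹ q)

  K*K⁻¹≈1 : K *ᴹ K⁻¹ ≈ᴹ 1ᴹ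
  K*K⁻¹≈1 = T.trans (block-* _ _ _ _ _ _ _ _) (T.trans (block-cong
    (1*x+0*y≈x 1ᴹ (-ᴹ 1ᴹ))
    (1*x+0*y≈x 0ᴹ 1ᴹ)
    (S.trans (1*x+1*y≈x+y 1ᴹ (-ᴹ 1ᴹ)) (S.-‿inverseʳ 1ᴹ))
    (S.trans (1*x+1*y≈x+y 0ᴹ 1ᴹ) (S.+-identityˡ 1ᴹ))) block-1ᴹ)

  K⁻¹*K≈1 : K⁻¹ *ᴹ K ≈ᴹ 1ᴹ
  K⁻¹*K≈1 = T.trans (block-* _ _ _ _ _ _ _ _) (T.trans (block-cong
    (1*x+0*y≈x 1ᴹ 1ᴹ)
    (1*x+0*y≈x 0ᴹ 1ᴹ)
    (S.trans (S.+-cong (S.*-identityʳ (-ᴹ 1ᴹ)) (S.*-identityʳ 1ᴹ)) (S.-‿inverseˡ 1ᴹ))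
    (x*0+y*1≈y (-ᴹ 1ᴹ) 1ᴹ)) block-1ᴹ)

  -- A column operation: the second block column is subtracted from the first. The lower row `(I O)`
  -- is unaffected because its second block is zero.
  elementary-*-K⁻¹ : ∀ p q → elementary p q *ᴹ K⁻¹ ≈ᴹ elementary (p -ᴹ q) q
  elementary-*-K⁻¹ p q = T.trans (block-* _ _ _ _ _ _ _ _) (block-cong
    (x*1+y*-1≈x-y p q)
    (x*0+y*1≈y p q)
    (1*x+0*y≈x 1ᴹ (-ᴹ 1ᴹ))
    (1*x+0*y≈x 0ᴹ 1ᴹ))

  -- A row operation: the lower row `(I O)` is added to the upper one, so only the first block
  -- changes, by `I`.
  U-*-elementary : ∀ u s → U *ᴹ elementary u s ≈ᴹ elementary (u +ᴹ 1ᴹ) s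
  U-*-elementary u s = T.trans (block-* _ _ _ _ _ _ _ _) (block-cong
    (1*x+1*y≈x+y u 1ᴹ)
    (S.trans (1*x+1*y≈x+y s 0ᴹ) (S.+-identityʳ s))
    (0*x+1*y≈y u 1ᴹ)
    (0*x+1*y≈y s 0ᴹ))

  -- The lower row of the product is the upper row `(I O)` of `X p q`, so the product is again
  -- elementary.
  elementary-*-X : ∀ u s p q →
    elementary u s *ᴹ X p q ≈ᴹ elementary (u -ᴹ s *ᴹ (p +ᴹ 1ᴹ)) (-ᴹ (s *ᴹ q))
  elementary-*-X u s p q = T.trans (block-* _ _ _ _ _ _ _ _) (block-cong
    (x*1+y*-z≈x-y*z u s (p +ᴹ 1ᴹ))
    (S.trans (x*0+y*z≈y*z u s (-ᴹ q)) (S.sym (SP.-‿distribʳ-* s q)))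
    (1*x+0*y≈x 1ᴹ (-ᴹ (p +ᴹ 1ᴹ)))
    (1*x+0*y≈x 0ᴹ (-ᴹ q)))

  -[U*X]≈K*elementary : ∀ p q → -ᴹ (U *ᴹ X p q) ≈ᴹ K *ᴹ elementary p q
  -[U*X]≈K*elementary p q =
    T.trans (T.-‿cong (block-* _ _ _ _ _ _ _ _)) (T.trans (-ᴹ-block _ _ _ _) (T.trans (block-cong
      (S.trans (S.-‿cong (1*x+1*y≈x+y 1ᴹ (-ᴹ (p +ᴹ 1ᴹ))))
        (S.trans (-[y-[x+y]]≈x p 1ᴹ) (S.sym (1*x+0*y≈x p 1ᴹ))))
      (S.trans (S.-‿cong (1*x+1*y≈x+y 0ᴹ (-ᴹ q)))
        (S.trans (-[0-x]≈x q) (S.sym (1*x+0*y≈x q 0ᴹ))))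
      (S.trans (S.-‿cong (0*x+1*y≈y 1ᴹ (-ᴹ (p +ᴹ 1ᴹ))))
        (S.trans (SP.-‿involutive (p +ᴹ 1ᴹ)) (S.sym (1*x+1*y≈x+y p 1ᴹ))))
      (S.trans (S.-‿cong (0*x+1*y≈y 0ᴹ (-ᴹ q)))
        (S.trans (SP.-‿involutive q) (S.sym (S.trans (1*x+1*y≈x+y q 0ᴹ) (S.+-identityʳ q))))))
      (T.sym (block-* _ _ _ _ _ _ _ _))))

-- The composition when both lengths are at least two.

module Composition {r ℓ} (R : CommutativeRing r ℓ) (l : ℕ) where

  open Quiddity R l
  open MatrixAlgebra R using (matrixRing)
  open BlockAlgebra R l using (block-1ᴹ)
  open Factors R l
  open RingIdentities (matrixRing (l + l)) using (x*-1*y≈-[x*y]; -1-central)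
  open Ring (matrixRing (l + l)) hiding (zero; _+_)
  -- In the opposite monoid, sum is leftProduct.
  open MonoidSums (Flip.monoid *-monoid)

  -block-1ᴹ : -ᴹ block 1ᴹ 0ᴹ 0ᴹ 1ᴹ ≈ᴹ -ᴹ 1ᴹ
  -block-1ᴹ = -‿cong block-1ᴹ

  elementary-≡ : ∀ {p p′ q q′} → p ≡ p′ → q ≡ q′ → elementary p q ≈ᴹ elementary p′ q′
  elementary-≡ ≡.refl ≡.refl = refl

  -- Agrees by definition with the local `u′` and `s′` of `_∘[_]_`, so the composite unfolds to a
  -- splice of this bi-vector.
  inserted : BiVector (suc n) → Fin (suc n) → BiVector (suc m) → BiVector (suc m)
  inserted {m = m} (p ⨾ q) k (u ⨾ s) =
    updateAt (updateAt u zero (_-ᴹ s zero *ᴹ (p k +ᴹ 1ᴹ))) (fromℕ m) (_+ᴹ 1ᴹ) ⨾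
    updateAt s zero (λ s₁ → -ᴹ (s₁ *ᴹ q k))

  factors : BiVector n → Vector (Matrix (l + l) (l + l)) n
  factors (p ⨾ q) = zipWith elementary p q

  -- The first and last positions of `w` are distinct here, so `X` and `U` can be split off at
  -- opposite ends of the product. What remains between them is the original product of `w`, a
  -- central `-1`.
  leftProduct-inserted :
    (v : BiVector (suc n)) (k : Fin (suc n)) (w : BiVector (suc (suc m))) → LMQB _ w →
    leftProduct (factors (inserted v k w)) ≈ᴹ K *ᴹ factors v k
  leftProduct-inserted {m = m} v@(p ⨾ q) k w@(u ⨾ s) w∈ = begin
    leftProduct ys                          ≈⟨ sum-head mid ys ys₀ (λ _ → refl) ⟩
    leftProduct mid *ᴹ X (p k) (q k)        ≈⟨ *-congʳ (sum-last xs mid midₘ midᵢ) ⟩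
    (U *ᴹ leftProduct xs) *ᴹ X (p k) (q k)  ≈⟨ *-congʳ (*-congˡ (trans w∈ -block-1ᴹ)) ⟩
    (U *ᴹ -ᴹ 1ᴹ) *ᴹ X (p k) (q k)           ≈⟨ x*-1*y≈-[x*y] U (X (p k) (q k)) ⟩
    -ᴹ (U *ᴹ X (p k) (q k))                 ≈⟨ -[U*X]≈K*elementary (p k) (q k) ⟩
    K *ᴹ elementary (p k) (q k)             ∎
    where
    open Relation.Binary.Reasoning.Setoid setoid
    xs ys mid : Vector (Matrix (l + l) (l + l)) (suc (suc m))
    xs  = factors w
    ys  = factors (inserted v k w)
    -- The intermediate stage: the first factor is still unmodified, while the last is already
    -- modified.
    mid = head xs ∷ tail ys

    ys₀ : ys zero ≈ᴹ mid zero *ᴹ X (p k) (q k)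
    ys₀ = sym (elementary-*-X (u zero) (s zero) (p k) (q k))

    midₘ : mid (fromℕ (suc m)) ≈ᴹ U *ᴹ xs (fromℕ (suc m))
    midₘ = trans (elementary-≡ (updateAt-updates (fromℕ m) (tail u)) ≡.refl)
                 (sym (U-*-elementary _ _))

    midᵢ : ∀ i → i ≢ fromℕ (suc m) → mid i ≈ᴹ xs i
    midᵢ zero    _  = refl
    midᵢ (suc i) i≢ =
      elementary-≡ (updateAt-minimal i (fromℕ m) (tail u) (i≢ ∘ ≡.cong suc)) ≡.refl

  LMQB-∘ : (v : BiVector (suc (suc n))) (w : BiVector (suc (suc m))) →
           LMQB _ v → LMQB _ w → (k : Fin (suc (suc n))) → LMQB _ (v ∘[ k ] w)
  LMQB-∘ {n} {m} v@(p ⨾ q) w v∈ w∈ k = begin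
    leftProduct (factors (v ∘[ k ] w))     ≡⟨ sum-cong-≗ (zipWith-splice elementary p′ q k (𝔭 w′) (𝔮 w′)) ⟩
    leftProduct (splice zs k (factors w′)) ≈⟨ sum-splice zs k (factors w′) ⟩
    -- Here `a` is `K` and `b` is `K⁻¹`. Multiplication is reversed, so `a ∙ b` is `K⁻¹ *ᴹ K` and
    -- `b ∙ z` is `z *ᴹ K⁻¹`.
    leftProduct ys                         ≈⟨ sum-cyclicallyAdjacent K⁻¹*K≈1 K*K⁻¹≈1 central xs ys k
                                                ysₖ ysₖ₊₁ ysᵢ v∈ ⟩
    -ᴹ block 1ᴹ 0ᴹ 0ᴹ 1ᴹ                   ∎
    where
    open Relation.Binary.Reasoning.Setoid setoid
    p′ = updateAt p (next k) (_-ᴹ q (next k))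
    w′ = inserted v k w
    xs ys zs : Vector (Matrix (l + l) (l + l)) (suc (suc n))
    xs = factors v
    zs = factors (p′ ⨾ q)
    ys = updateAt zs k (const (leftProduct (factors w′)))

    central : (-ᴹ block 1ᴹ 0ᴹ 0ᴹ 1ᴹ) *ᴹ K⁻¹ ≈ᴹ K⁻¹ *ᴹ (-ᴹ block 1ᴹ 0ᴹ 0ᴹ 1ᴹ)
    central = trans (*-congʳ -block-1ᴹ) (trans (-1-central K⁻¹) (*-congˡ (sym -block-1ᴹ)))

    ysₖ : ys k ≈ᴹ K *ᴹ xs k
    ysₖ = trans (reflexive (updateAt-updates k zs)) (leftProduct-inserted v k w w∈)

    ysₖ₊₁ : ys (next k) ≈ᴹ xs (next k) *ᴹ K⁻¹
    ysₖ₊₁ = trans (reflexive (updateAt-minimal (next k) k zs (next≢ k)))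
              (trans (elementary-≡ (updateAt-updates (next k) p) ≡.refl)
                     (sym (elementary-*-K⁻¹ _ _)))

    ysᵢ : ∀ i → i ≢ k → i ≢ next k → ys i ≈ᴹ xs i
    ysᵢ i i≢k i≢k₊₁ = trans (reflexive (updateAt-minimal i k zs i≢k))
                        (elementary-≡ (updateAt-minimal i (next k) p i≢k₊₁) ≡.refl)

-- Bi-sequences of length one, and the general statement.

module _ {r ℓ} (R : CommutativeRing r ℓ) where

  open CommutativeRing R hiding (zero; _+_)
  open Algebra.Properties.Ring ring using (-0#≈0#)

  -- M(p,q) has lower left block I, so it equals -1 only over the zero ring.
  LMQB₁⇒trivial : ∀ l → let open Quiddity R (suc l) in
                  (v : BiVector 1) → LMQB 1 v → ∀ x y → x ≈ y
  LMQB₁⇒trivial l v v∈ x y = trans (x≈0 x) (sym (x≈0 y))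
    where
    open Quiddity R (suc l)
    open MatrixAlgebra R using (matrixRing)

    i₀ j₀ : Fin (suc l + suc l)
    i₀ = suc l ↑ʳ zero
    j₀ = zero

    block-i₀j₀ : ∀ A B C D → block A B C D i₀ j₀ ≡ C zero zero
    block-i₀j₀ A B C D =
      ≡.cong (λ row → row j₀) (lookup-++ʳ (zipWith _++_ A B) (zipWith _++_ C D) zero)

    M : Matrix (suc l + suc l) (suc l + suc l)
    M = elementary (𝔭 v zero) (𝔮 v zero)

    1≈0 : 1# ≈ 0#
    1≈0 = begin
      1#                             ≡⟨ block-i₀j₀ (𝔭 v zero) (𝔮 v zero) 1ᴹ 0ᴹ ⟨
      -- The fold in `leftProduct` starts from `1ᴹ`, so at length one the hypothesis concerns
      -- `1ᴹ *ᴹ M`.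
      M i₀ j₀                        ≈⟨ Ring.*-identityˡ (matrixRing _) M i₀ j₀ ⟨
      (1ᴹ *ᴹ M) i₀ j₀                ≈⟨ v∈ i₀ j₀ ⟩
      - block 1ᴹ 0ᴹ 0ᴹ 1ᴹ i₀ j₀      ≡⟨ ≡.cong -_ (block-i₀j₀ 1ᴹ 0ᴹ 0ᴹ 1ᴹ) ⟩
      - 0#                           ≈⟨ -0#≈0# ⟩
      0#                             ∎
      where open Relation.Binary.Reasoning.Setoid setoid

    x≈0 : ∀ x → x ≈ 0#
    x≈0 x = trans (sym (*-identityˡ x)) (trans (*-congʳ 1≈0) (zeroˡ x))

theorem32 : ∀ {r ℓ} (R : CommutativeRing r ℓ) (l : ℕ) → 1 ≤ l →
    let open Quiddity R l in
    (n m : ℕ) (v : BiVector (suc n)) (w : BiVector (suc m)) →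
    LMQB (suc n) v → LMQB (suc m) w →
    (k : Fin (suc n)) → LMQB (suc n + suc m ∸ 1) (v ∘[ k ] w)
-- If either length is one, the ring is trivial and any two entries are equal. The remaining case
-- has both lengths at least two, and `suc n + suc m ∸ 1` reduces to the length `n + suc m` of the
-- splice.
theorem32 R (suc l) _ zero    m       v w v∈ _  k _ _ = LMQB₁⇒trivial R l v v∈ _ _
theorem32 R (suc l) _ (suc n) zero    v w _  w∈ k _ _ = LMQB₁⇒trivial R l w w∈ _ _
theorem32 R (suc l) _ (suc n) (suc m) v w v∈ w∈ k     = Composition.LMQB-∘ R (suc l) v w v∈ w∈ k
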